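{- Let $G$ be a fixed edge-ordered graph with minimal edge $e_0$ and maximal edge $e_{\max}$. If $e_0$ and $e_{\max}$ are both isolated in $G$, then either $sat_e(n,G)=O(1)$ or $sat_e(n,G)=\Omega(n)$. Otherwise, $sat_e(n,G)=\Omega(n)$.
   Context: An edge-ordered graph is a finite simple graph together with a linear order on its edge set (usually given by an injective labeling $l:E\to\mathbb{N}$ or $l:E\to\mathbb{R}$). An edge-ordered graph $H$ contains $G$ (has a copy of $G$) if $G$ is isomorphic, by an isomorphism respecting the edge-order, to a subgraph of $H$ with the induced order; otherwise $H$ is $G$-free. The minimal (maximal) edge is the edge with the smallest (largest) label; an edge is isolated if it shares no vertex with any other edge. $sat_e(n,G)$ is the minimum number of edges in a $G$-free edge-ordered graph $H$ on $n$ vertices such that adding to $H$ any missing edge, inserted at an arbitrary position of the linear order of the edges, creates a copy of $G$ (i.e. for every missing edge and every position, a copy is created). Asymptotic notation is for $n\to\infty$ with $G$ fixed ($n$ is assumed large enough). -}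

module Defs where

open import Data.Fin.Base as Fin using (Fin; punchOut; combine)
import Data.Fin.Properties as Fin
open import Data.Nat.Base
  using (ℕ; zero; suc; _+_; _*_; _≤_; z≤n; s≤s; NonZero; >-nonZero⁻¹)
import Data.Nat.Properties as ℕ
open import Data.Product.Base using (Σ; ∃; ∃-syntax; ∃₂; _×_; _,_; proj₁; proj₂)
open import Data.Sum.Base as Sum using (_⊎_)
open import Data.Vec.Base using (Vec; []; _∷_; lookup; insertAt; tabulate)
open import Data.Vec.Properties using (insertAt-lookup; insertAt-punchIn; lookup∘tabulate)
open import Function.Base using (_∘_)
open import Function.Definitions using (Injective)
open import Relation.Binary.PropositionalEquality
  using (_≡_; _≢_; _≗_; refl; sym; trans; subst; subst₂; cong)
open import Relation.Nullary using (¬_; Dec; yes; no; contradiction)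
open import Relation.Nullary.Decidable
  using (map′; ¬?; _×-dec_; _⊎-dec_; _→-dec_; decidable-stable; recompute)
open import Relation.Unary using (Decidable)

private variable
  n m v k : ℕ

------------------------------------------------------------------------
-- Edge-ordered graphs

-- An unordered pair of distinct vertices, listed in increasing order so
-- that propositional equality of edges is equality of 2-element sets.
record Edge (n : ℕ) : Set where
  constructor edge
  field
    lo hi  : Fin n
    .lo<hi : lo Fin.< hi

open Edge public

infix 4 _∈ₑ_

_∈ₑ_ : Fin n → Edge n → Set
u ∈ₑ e = u ≡ lo e ⊎ u ≡ hi e

-- A simple graph on the vertex set Fin n with m linearly ordered edges,
-- enumerated in increasing order: the index of an edge is its label, and
-- the edge-order is the order of Fin m.
record EdgeOrderedGraph (n m : ℕ) : Set where
  constructor graph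
  field
    edges    : Vec (Edge n) m
    distinct : Injective _≡_ _≡_ (lookup edges)

open EdgeOrderedGraph public

Isolated : EdgeOrderedGraph n m → Fin m → Set
Isolated G i =
  ∀ j → j ≢ i → ∀ u → u ∈ₑ lookup (edges G) i → ¬ (u ∈ₑ lookup (edges G) j)

------------------------------------------------------------------------
-- Containment

MapsTo : (Fin v → Fin n) → Edge v → Edge n → Set
MapsTo φ e f = (φ (lo e) ≡ lo f × φ (hi e) ≡ hi f) ⊎ (φ (lo e) ≡ hi f × φ (hi e) ≡ lo f)

-- φ acts on vertices and ψ on edges, given by their labels.  The image is
-- a subgraph of H, not necessarily an induced one.
IsCopy : EdgeOrderedGraph v m → EdgeOrderedGraph n k →
         (Fin v → Fin n) → (Fin m → Fin k) → Set
IsCopy G H φ ψ =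
  (∀ u w → φ u ≡ φ w → u ≡ w) ×
  (∀ i j → i Fin.< j → ψ i Fin.< ψ j) ×
  (∀ i → MapsTo φ (lookup (edges G) i) (lookup (edges H) (ψ i)))

Contains : EdgeOrderedGraph n k → EdgeOrderedGraph v m → Set
Contains H G = ∃₂ λ φ ψ → IsCopy G H φ ψ

------------------------------------------------------------------------
-- Saturation

Missing : EdgeOrderedGraph n k → Edge n → Set
Missing H e = ∀ i → lookup (edges H) i ≢ e

private
  lookup-punchOut : ∀ (es : Vec (Edge n) k) p e {j} (p≢j : p ≢ j) →
                    lookup (insertAt es p e) j ≡ lookup es (punchOut p≢j)
  lookup-punchOut es p e p≢j =
    trans (cong (lookup (insertAt es p e)) (sym (Fin.punchIn-punchOut p≢j)))
          (insertAt-punchIn es p e (punchOut p≢j))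

insertAt-distinct : (es : Vec (Edge n) k) → Injective _≡_ _≡_ (lookup es) →
                    ∀ p e → (∀ i → lookup es i ≢ e) →
                    Injective _≡_ _≡_ (lookup (insertAt es p e))
insertAt-distinct es inj p e missing {i} {j} eq with p Fin.≟ i | p Fin.≟ j
... | yes refl | yes refl = refl
... | yes refl | no  p≢j  = contradiction
  (trans (sym (lookup-punchOut es p e p≢j)) (trans (sym eq) (insertAt-lookup es p e)))
  (missing (punchOut p≢j))
... | no  p≢i  | yes refl = contradiction
  (trans (sym (lookup-punchOut es p e p≢i)) (trans eq (insertAt-lookup es p e)))
  (missing (punchOut p≢i))
... | no  p≢i  | no  p≢j  = Fin.punchOut-injective p≢i p≢j
  (inj (trans (sym (lookup-punchOut es p e p≢i)) (trans eq (lookup-punchOut es p e p≢j))))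

-- The new edge gets label p; the labels ≥ p of old edges are shifted up.
insertEdge : (H : EdgeOrderedGraph n k) (e : Edge n) → Missing H e →
             Fin (suc k) → EdgeOrderedGraph n (suc k)
insertEdge H e missing p = graph (insertAt (edges H) p e)
  (insertAt-distinct (edges H) (distinct H) p e missing)

record Saturated (G : EdgeOrderedGraph v m) (H : EdgeOrderedGraph n k) : Set where
  constructor saturated
  field
    free    : ¬ Contains H G
    creates : ∀ e (missing : Missing H e) p → Contains (insertEdge H e missing p) G

SaturatedSize : EdgeOrderedGraph v m → ℕ → ℕ → Set
SaturatedSize G n k = ∃[ H ] Saturated {n = n} {k = k} G H

IsMinimumOf : (ℕ → Set) → ℕ → Set
IsMinimumOf P k = P k × (∀ j → P j → k ≤ j)

------------------------------------------------------------------------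
-- Deciding saturation by exhaustive search

Searchable : Set → Set₁
Searchable A = {P : A → Set} → Decidable P → Dec (∃ P)

search-vec : ∀ {A} → Searchable A → Searchable (Vec A n)
search-vec {n = zero}  s P? = map′ ([] ,_) (λ { ([] , p) → p }) (P? [])
search-vec {n = suc n} s P? =
  map′ (λ { (x , xs , p) → x ∷ xs , p }) (λ { (x ∷ xs , p) → x , xs , p })
       (s λ x → search-vec s λ xs → P? (x ∷ xs))

search-edge : Searchable (Edge n)
search-edge {P = P} P? =
  map′ (λ { (a , b , a<b , p) → edge a b a<b , p })
       (λ { (edge a b a<b , p) → a , b , recompute (a Fin.<? b) a<b , p })
       (Fin.any? λ a → Fin.any? λ b → at a b)
  where
  at : ∀ a b → Dec (Σ (a Fin.< b) λ a<b → P (edge a b a<b))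
  at a b with a Fin.<? b
  ... | no  a≮b = no (a≮b ∘ proj₁)
  ... | yes a<b = map′ (a<b ,_) proj₂ (P? (edge a b a<b))

-- Without function extensionality, P has to respect pointwise equality.
search-fun : ∀ {P : (Fin m → Fin n) → Set} → (∀ {f g} → f ≗ g → P f → P g) →
             Decidable P → Dec (∃ P)
search-fun resp P? =
  map′ (λ { (xs , p) → lookup xs , p })
       (λ { (f , p) → tabulate f , resp (λ i → sym (lookup∘tabulate f i)) p })
       (search-vec Fin.any? (P? ∘ lookup))

infix 4 _≟ₑ_

_≟ₑ_ : (e f : Edge n) → Dec (e ≡ f)
edge a b _ ≟ₑ edge c d _ =
  map′ (λ { (refl , refl) → refl }) (λ { refl → refl , refl })
       (a Fin.≟ c ×-dec b Fin.≟ d)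

module _ (G : EdgeOrderedGraph v m) where

  isCopy? : (H : EdgeOrderedGraph n k) → ∀ φ ψ → Dec (IsCopy G H φ ψ)
  isCopy? H φ ψ =
    (Fin.all? λ u → Fin.all? λ w → (φ u Fin.≟ φ w) →-dec (u Fin.≟ w)) ×-dec
    (Fin.all? λ i → Fin.all? λ j → (i Fin.<? j) →-dec (ψ i Fin.<? ψ j)) ×-dec
    (Fin.all? λ i → ((_ Fin.≟ _) ×-dec (_ Fin.≟ _)) ⊎-dec ((_ Fin.≟ _) ×-dec (_ Fin.≟ _)))

  isCopy-resp : (H : EdgeOrderedGraph n k) → ∀ {φ φ′ ψ ψ′} → φ ≗ φ′ → ψ ≗ ψ′ →
                IsCopy G H φ ψ → IsCopy G H φ′ ψ′
  isCopy-resp H {φ} {φ′} {ψ} {ψ′} φ≗ ψ≗ (inj , mono , maps) =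
    (λ u w eq → inj u w (trans (φ≗ u) (trans eq (sym (φ≗ w))))) ,
    (λ i j i<j → subst₂ Fin._<_ (ψ≗ i) (ψ≗ j) (mono i j i<j)) ,
    (λ i → subst (MapsTo φ′ (lookup (edges G) i) ∘ lookup (edges H)) (ψ≗ i)
             (Sum.map move move (maps i)))
    where
    move : ∀ {a b c d} → φ a ≡ c × φ b ≡ d → φ′ a ≡ c × φ′ b ≡ d
    move (p , q) = trans (sym (φ≗ _)) p , trans (sym (φ≗ _)) q

  contains? : (H : EdgeOrderedGraph n k) → Dec (Contains H G)
  contains? H =
    search-fun (λ φ≗ (ψ , c) → ψ , isCopy-resp H {ψ = ψ} φ≗ (λ _ → refl) c) λ φ →
    search-fun (isCopy-resp H {φ} (λ _ → refl)) (isCopy? H φ)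

  ExtendableAt : EdgeOrderedGraph n k → Edge n → Set
  ExtendableAt H e =
    Σ (Missing H e) λ missing → ∃[ p ] ¬ Contains (insertEdge H e missing p) G

  Extendable : EdgeOrderedGraph n k → Set
  Extendable H = ∃ (ExtendableAt H)

  extendable? : (H : EdgeOrderedGraph n k) → Dec (Extendable H)
  extendable? H = search-edge at
    where
    at : ∀ e → Dec (ExtendableAt H e)
    at e with Fin.all? (λ i → ¬? (lookup (edges H) i ≟ₑ e))
    ... | no  present = no (present ∘ proj₁)
    ... | yes missing = map′ (missing ,_) proj₂
                          (Fin.any? λ p → ¬? (contains? (insertEdge H e missing p)))

  ¬extendable⇒creates : (H : EdgeOrderedGraph n k) → ¬ Extendable H →
    ∀ e (missing : Missing H e) p → Contains (insertEdge H e missing p) G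
  ¬extendable⇒creates H ¬ext e missing p =
    decidable-stable (contains? (insertEdge H e missing p)) λ free →
      ¬ext (e , missing , p , free)

  saturated? : (H : EdgeOrderedGraph n k) → Dec (Saturated G H)
  saturated? H =
    map′ (λ { (free , ¬ext) → saturated free (¬extendable⇒creates H ¬ext) })
         (λ { (saturated free creates) →
                free , λ { (e , missing , p , ¬c) → ¬c (creates e missing p) } })
         (¬? (contains? H) ×-dec ¬? (extendable? H))

  saturatedSize? : ∀ n k → Dec (SaturatedSize G n k)
  saturatedSize? n k =
    map′ (λ { (es , inj , s) → graph es (λ {i} {j} → inj i j) , s })
         (λ { (graph es inj , s) → es , (λ i j → inj) , s })
         (search-vec search-edge at)
    where
    at : (es : Vec (Edge n) k) →
         Dec (Σ (∀ i j → lookup es i ≡ lookup es j → i ≡ j) λ inj →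
              Saturated G (graph es (λ {i} {j} → inj i j)))
    at es with Fin.all? (λ i → Fin.all? λ j → (lookup es i ≟ₑ lookup es j) →-dec (i Fin.≟ j))
    ... | no ¬inj = no (¬inj ∘ proj₁)
    ... | yes inj = map′ (inj ,_)
      (λ { (_ , saturated free creates) → saturated free creates })
      (saturated? (graph es (λ {i} {j} → inj i j)))

------------------------------------------------------------------------
-- The saturation number

size≤n*n : EdgeOrderedGraph n k → k ≤ n * n
size≤n*n {n = n} H = Fin.injective⇒≤ {f = λ i → code (lookup (edges H) i)}
  (distinct H ∘ code-injective)
  where
  code : Edge n → Fin (n * n)
  code e = combine (lo e) (hi e)

  code-injective : Injective _≡_ _≡_ code
  code-injective {edge a b _} {edge c d _} eq
    with refl , refl ← Fin.combine-injective a b c d eq = refl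

least : ∀ {P : ℕ → Set} → Decidable P → ∃ P → ∃ (IsMinimumOf P)
least {P} P? (k , p) = go P? k p
  where
  go : ∀ {P : ℕ → Set} → Decidable P → ∀ k → P k → ∃ (IsMinimumOf P)
  go P? k p with P? 0
  ... | yes p₀ = 0 , p₀ , λ _ _ → z≤n
  go P? zero    p | no ¬p₀ = contradiction p ¬p₀
  go P? (suc k) p | no ¬p₀ with go (P? ∘ suc) k p
  ... | l , pl , min = suc l , pl ,
    λ { zero p₀ → contradiction p₀ ¬p₀ ; (suc j) pj → s≤s (min j pj) }

module _ .{{_ : NonZero m}} (G : EdgeOrderedGraph v m) where

  -- Greedy extension of the edgeless graph, which is G-free as m ≠ 0.
  ∃-saturatedSize : ∀ n → ∃ (SaturatedSize G n)
  ∃-saturatedSize n = extend (n * n) (graph [] λ { {()} }) (ℕ.m≤m+n _ _) edgeless-free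
    where
    edgeless-free : ¬ Contains {n = n} (graph [] λ { {()} }) G
    edgeless-free (_ , ψ , _) with () ← ψ (Fin.fromℕ< (>-nonZero⁻¹ m))

    extend : ∀ fuel (H : EdgeOrderedGraph n k) → n * n ≤ fuel + k → ¬ Contains H G →
             ∃ (SaturatedSize G n)
    extend fuel H bound free with extendable? G H
    ... | no ¬ext = _ , H , saturated free (¬extendable⇒creates G H ¬ext)
    extend zero       H bound free | yes (e , missing , p , _) =
      contradiction (ℕ.≤-trans (size≤n*n (insertEdge H e missing p)) bound) ℕ.1+n≰n
    extend (suc fuel) H bound free | yes (e , missing , p , free′) =
      extend fuel (insertEdge H e missing p)
        (ℕ.≤-trans bound (ℕ.≤-reflexive (sym (ℕ.+-suc fuel _)))) free′

  satₑ-exists : ∀ n → ∃ (IsMinimumOf (SaturatedSize G n))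
  satₑ-exists n = least (saturatedSize? G n) (∃-saturatedSize n)

  satₑ : ℕ → ℕ
  satₑ n = proj₁ (satₑ-exists n)

  satₑ-isMinimum : ∀ n → IsMinimumOf (SaturatedSize G n) (satₑ n)
  satₑ-isMinimum n = proj₂ (satₑ-exists n)

------------------------------------------------------------------------
-- Asymptotic notation

infix 4 _∈O_ _∈Ω_

_∈O_ : (ℕ → ℕ) → (ℕ → ℕ) → Set
f ∈O g = ∃[ C ] ∃[ N ] ∀ n → N ≤ n → f n ≤ C * g n

-- The usual positive constant c in c · g n ≤ f n is 1/C.
_∈Ω_ : (ℕ → ℕ) → (ℕ → ℕ) → Set
f ∈Ω g = ∃[ C ] ∃[ N ] ∀ n → N ≤ n → g n ≤ C * f n

{-# OPTIONS --safe #-}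
-- In a saturated H, two isolated vertices a, b can be joined by a new edge of
-- minimal (maximal) label, which then plays the role of e₀ (eₘₐₓ) in a copy of
-- G; so that edge of G is isolated.  Hence, if e₀ or eₘₐₓ is not isolated, H
-- has at most one isolated vertex and at least (n - 1) / 2 edges.
--
-- In general, either every saturated H on n vertices with k edges satisfies
-- n < 2 k + 2 + v, which is a linear bound, or some H has at least 2 + v
-- isolated vertices.  Such an H stays saturated when one more isolated vertex
-- is added: the new vertex is interchangeable with an old isolated one, and
-- isolated vertices of G can be placed on isolated vertices of H.  Then k
-- bounds satₑ at every larger number of vertices.
module Submission where

open import Defs
open import Axiom.ExcludedMiddle using (ExcludedMiddle)
open import Data.Fin.Base
  using (Fin; zero; suc; fromℕ; splitAt; _↑ˡ_; _↑ʳ_; punchOut; _≤_; _<_)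
import Data.Fin.Properties as Fin
open import Data.Nat.Base as ℕ using (ℕ; zero; suc; _+_; _*_; _∸_; NonZero; s<s)
import Data.Nat.Properties as ℕ
open import Data.Product.Base using (∃; ∃-syntax; _×_; _,_; proj₁; proj₂; swap)
open import Data.Sum.Base as Sum using (_⊎_; inj₁; inj₂; [_,_]′)
open import Data.Vec.Base using (Vec; _∷_; lookup; insertAt; map)
import Data.Vec.Functional as F
open import Data.Vec.Properties using (insertAt-lookup; insertAt-punchIn; lookup-map)
open import Function.Base using (_∘_)
open import Function.Definitions using (Injective)
open import Level using (0ℓ)
open import Relation.Binary.Definitions using (Minimum; Maximum; tri<; tri≈; tri>)
open import Relation.Binary.PropositionalEquality
  using (_≡_; _≢_; refl; sym; trans; subst; cong)
open import Relation.Nullary using (¬_; Dec; yes; no; contradiction)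
open import Relation.Nullary.Decidable using (¬?; _⊎-dec_; decidable-stable; toSum)

private variable
  a n n′ m v k r : ℕ

-- Pigeonhole and vertices not covered by any edge.

-- Pigeonhole: if `f` were onto, choosing preimages would inject `Fin n` into `Fin a`.
fresh : (f : Fin a → Fin n) → a ℕ.< n → ∃[ w ] ∀ i → f i ≢ w
fresh {a} {n} f a<n with Fin.any? (λ w → ¬? (Fin.any? λ i → f i Fin.≟ w))
... | yes (w , w∉) = w , λ i eq → w∉ (i , eq)
... | no  none     = contradiction (Fin.injective⇒≤ g-injective) (ℕ.<⇒≱ a<n)
  where
  preimage : ∀ w → ∃[ i ] f i ≡ w
  preimage w = decidable-stable (Fin.any? λ i → f i Fin.≟ w) λ w∉ → none (w , w∉)

  g-injective : Injective _≡_ _≡_ (proj₁ ∘ preimage)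
  g-injective {x} {y} eq =
    trans (sym (proj₂ (preimage x))) (trans (cong f eq) (proj₂ (preimage y)))

fresh-injection : (f : Fin a → Fin n) → a + r ℕ.≤ n →
                  ∃[ ι ] Injective _≡_ _≡_ ι × (∀ (x : Fin r) i → f i ≢ ι x)
fresh-injection {r = zero}  f a+r≤n = (λ ()) , (λ { {()} }) , λ ()
fresh-injection {a} {n} {suc r} f a+r≤n
  with w , w∉ ← fresh f (ℕ.≤-trans (ℕ.m<m+n a ℕ.z<s) a+r≤n)
  -- Adding `w` to the avoided values makes the later choices differ from it.
  with ι , inj , ι∉ ← fresh-injection {r = r} (w F.∷ f)
                        (subst (ℕ._≤ n) (ℕ.+-suc a r) a+r≤n)
  = w F.∷ ι
  , (λ { {zero}  {zero}  eq → refl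
       ; {zero}  {suc y} eq → contradiction eq (ι∉ y zero)
       ; {suc x} {zero}  eq → contradiction (sym eq) (ι∉ x zero)
       ; {suc x} {suc y} eq → cong suc (inj eq) })
  , λ { zero i → w∉ i ; (suc x) i → ι∉ x (suc i) }

Covered : EdgeOrderedGraph n k → Fin n → Set
Covered H u = ∃[ i ] u ∈ₑ lookup (edges H) i

covered? : (H : EdgeOrderedGraph n k) → ∀ u → Dec (Covered H u)
covered? H u = Fin.any? λ i → (u Fin.≟ _) ⊎-dec (u Fin.≟ _)

-- Lists endpoints with repetition, so that at most `k + k` vertices are covered.
endpoint : EdgeOrderedGraph n k → Fin (k + k) → Fin n
endpoint {k = k} H =
  [ (λ i → lo (lookup (edges H) i)) , (λ i → hi (lookup (edges H) i)) ]′ ∘ splitAt k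

covered⇒endpoint : (H : EdgeOrderedGraph n k) → ∀ {u} → Covered H u → ∃[ x ] endpoint H x ≡ u
covered⇒endpoint {k = k} H (i , inj₁ refl) =
  i ↑ˡ k , cong [ _ , _ ]′ (Fin.splitAt-↑ˡ k i k)
covered⇒endpoint {k = k} H (i , inj₂ refl) =
  k ↑ʳ i , cong [ _ , _ ]′ (Fin.splitAt-↑ʳ k k i)

uncovered-injection : (H : EdgeOrderedGraph n k) → k + k + r ℕ.≤ n →
  ∃[ ι ] Injective _≡_ _≡_ ι × (∀ (x : Fin r) → ¬ Covered H (ι x))
uncovered-injection H bound with ι , inj , ι∉ ← fresh-injection (endpoint H) bound =
  ι , inj , λ x c → ι∉ x _ (proj₂ (covered⇒endpoint H c))

-- Transferring copies along a correspondence of vertices.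

edge-≡ : {e f : Edge n} → lo e ≡ lo f → hi e ≡ hi f → e ≡ f
edge-≡ {e = edge _ _ _} {f = edge _ _ _} refl refl = refl

-- `MapsTo φ` is the case where `R` is the graph of `φ`. A relation also allows partial
-- correspondences, in which an extra isolated vertex has no partner.
Match : (Fin n → Fin n′ → Set) → Edge n → Edge n′ → Set
Match R e f = (R (lo e) (lo f) × R (hi e) (hi f)) ⊎ (R (lo e) (hi f) × R (hi e) (lo f))

match-image : (R : Fin n → Fin n′ → Set) (e : Edge n) (f : Edge n′) → Match R e f →
              ∀ {u} → u ∈ₑ e → ∃[ w ] R u w × w ∈ₑ f
match-image R e f (inj₁ (p , q)) (inj₁ refl) = _ , p , inj₁ refl
match-image R e f (inj₁ (p , q)) (inj₂ refl) = _ , q , inj₂ refl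
match-image R e f (inj₂ (p , q)) (inj₁ refl) = _ , p , inj₂ refl
match-image R e f (inj₂ (p , q)) (inj₂ refl) = _ , q , inj₁ refl

pair : (a b : Fin n) → a ≢ b →
       ∃[ e ] ((a ≡ lo e × b ≡ hi e) ⊎ (a ≡ hi e × b ≡ lo e))
pair a b a≢b with Fin.<-cmp a b
... | tri< a<b _ _ = edge a b a<b , inj₁ (refl , refl)
... | tri≈ _ a≡b _ = contradiction a≡b a≢b
... | tri> _ _ b<a = edge b a b<a , inj₂ (refl , refl)

insertAt-zip : ∀ {A B : Set} (Q : A → B → Set) (xs : Vec A k) (ys : Vec B k) p {x y} →
  Q x y → (∀ i → Q (lookup xs i) (lookup ys i)) →
  ∀ j → Q (lookup (insertAt xs p x) j) (lookup (insertAt ys p y) j)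
insertAt-zip Q xs ys zero q qs zero = q
insertAt-zip Q xs ys zero q qs (suc j) = qs j
insertAt-zip Q (_ ∷ xs) (_ ∷ ys) (suc p) q qs zero = qs zero
insertAt-zip Q (_ ∷ xs) (_ ∷ ys) (suc p) q qs (suc j) =
  insertAt-zip Q xs ys p q (qs ∘ suc) j

-- R need only relate covered vertices, since the uncovered vertices of G go to
-- uncovered vertices of B.
transfer : (G : EdgeOrderedGraph v m) (R : Fin n → Fin n′ → Set) →
  (∀ {x y y′} → R x y → R x y′ → y ≡ y′) → (∀ {x x′ y} → R x y → R x′ y → x ≡ x′) →
  (A : EdgeOrderedGraph n k) (B : EdgeOrderedGraph n′ k) →
  (∀ i → Match R (lookup (edges A) i) (lookup (edges B) i)) → k + k + v ℕ.≤ n′ →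
  Contains A G → Contains B G
transfer {v = v} {n′ = n′} G R functional injective A B match bound
  (φ , ψ , φ-inj , ψ-mono , maps)
  with ι , ι-inj , ι-uncovered ← uncovered-injection {r = v} B bound
  = proj₁ ∘ image , ψ , image-injective , ψ-mono , image-maps
  where
  composite : ∀ i → Match (R ∘ φ) (lookup (edges G) i) (lookup (edges B) (ψ i))
  composite i with maps i | match (ψ i)
  ... | inj₁ (p , q) | rs rewrite p | q = rs
  ... | inj₂ (p , q) | rs rewrite p | q = Sum.swap (Sum.map swap swap rs)

  -- Vertices on edges of `G` follow `R`; the others discard their `φ`-value and take a reserved
  -- uncovered vertex. Recording `Covered B w` keeps the two kinds of image disjoint.
  Image : Fin v → Fin n′ → Set
  Image u w = (R (φ u) w × Covered B w) ⊎ (w ≡ ι u × ¬ Covered G u)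

  image : ∀ u → ∃ (Image u)
  image u with covered? G u
  ... | no uncovered = ι u , inj₂ (refl , uncovered)
  ... | yes (i , u∈)
    with w , r , w∈ ← match-image (R ∘ φ) (lookup (edges G) i) (lookup (edges B) (ψ i))
                        (composite i) u∈
    = w , inj₁ (r , _ , w∈)

  Image-injective : ∀ {u u′ w} → Image u w → Image u′ w → u ≡ u′
  Image-injective (inj₁ (p , _)) (inj₁ (q , _)) = φ-inj _ _ (injective p q)
  Image-injective (inj₁ (_ , c)) (inj₂ (refl , _)) = contradiction c (ι-uncovered _)
  Image-injective (inj₂ (refl , _)) (inj₁ (_ , c)) = contradiction c (ι-uncovered _)
  Image-injective (inj₂ (p , _)) (inj₂ (q , _)) = ι-inj (trans (sym p) q)

  image-injective : ∀ u u′ → proj₁ (image u) ≡ proj₁ (image u′) → u ≡ u′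
  image-injective u u′ eq =
    Image-injective (subst (Image u) eq (proj₂ (image u))) (proj₂ (image u′))

  image-unique : ∀ {u w} → Covered G u → R (φ u) w → proj₁ (image u) ≡ w
  image-unique {u} c r with image u
  ... | _ , inj₁ (r′ , _) = functional r′ r
  ... | _ , inj₂ (_ , uncovered) = contradiction c uncovered

  image-maps : ∀ i → MapsTo (proj₁ ∘ image) (lookup (edges G) i) (lookup (edges B) (ψ i))
  image-maps i = Sum.map both both (composite i)
    where
    both : ∀ {x y} → R (φ (lo (lookup (edges G) i))) x × R (φ (hi (lookup (edges G) i))) y →
           proj₁ (image (lo (lookup (edges G) i))) ≡ x ×
           proj₁ (image (hi (lookup (edges G) i))) ≡ y
    both (p , q) = image-unique (i , inj₁ refl) p , image-unique (i , inj₂ refl) q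

-- Adding an isolated vertex to a saturated graph.

sucEdge : Edge n → Edge (suc n)
sucEdge (edge a b a<b) = edge (suc a) (suc b) (s<s a<b)

addVertex : EdgeOrderedGraph n k → EdgeOrderedGraph (suc n) k
addVertex H = graph (map sucEdge (edges H)) λ {i} {j} eq →
  distinct H (sucEdge-injective
    (trans (sym (lookup-map i sucEdge (edges H))) (trans eq (lookup-map j sucEdge (edges H)))))
  where
  sucEdge-injective : Injective _≡_ _≡_ sucEdge
  sucEdge-injective eq =
    edge-≡ (Fin.suc-injective (cong lo eq)) (Fin.suc-injective (cong hi eq))

-- The new vertex `zero` lies on no edge, so a copy can use it only for an isolated vertex of `G`,
-- which `transfer` places elsewhere.
addVertex-free : (G : EdgeOrderedGraph v m) (H : EdgeOrderedGraph n k) →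
  k + k + v ℕ.≤ n → Contains (addVertex H) G → Contains H G
addVertex-free {n = n} G H bound = transfer G R (λ { refl refl → refl }) (λ { refl refl → refl })
  (addVertex H) H match bound
  where
  R : Fin (suc n) → Fin n → Set
  R x y = x ≡ suc y

  match : ∀ i → Match R (lookup (edges (addVertex H)) i) (lookup (edges H) i)
  match i rewrite lookup-map i sucEdge (edges H) = inj₁ (refl , refl)

addVertex-creates : (G : EdgeOrderedGraph v m) (H : EdgeOrderedGraph n k) → Saturated G H →
  k + k + (2 + v) ℕ.≤ n → ∀ e (missing : Missing (addVertex H) e) p →
  Contains (insertEdge (addVertex H) e missing p) G
addVertex-creates {v = v} {n = n} {k} G H sat bound e missing p = main e missing
  where
  -- The inserted edge brings two more endpoints; the 2 in `2 + v` pays for them.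
  bound′ : suc k + suc k + v ℕ.≤ suc n
  bound′ = ℕ.≤-trans (ℕ.≤-reflexive eq) (ℕ.m≤n⇒m≤1+n bound)
    where
    eq : suc k + suc k + v ≡ k + k + (2 + v)
    eq rewrite ℕ.+-suc k k | ℕ.+-suc (k + k) (suc v) | ℕ.+-suc (k + k) v = refl

  -- Room for a vertex `s` that avoids `b` and all `k + k` endpoints.
  2k+1<n : suc (k + k) ℕ.< n
  2k+1<n = ℕ.≤-trans (ℕ.≤-reflexive (sym (ℕ.+-comm (k + k) 2)))
                     (ℕ.≤-trans (ℕ.+-monoʳ-≤ (k + k) (ℕ.m≤m+n 2 v)) bound)

  -- τ identifies H with addVertex H minus an uncovered vertex.
  along : (τ : Fin n → Fin (suc n)) → Injective _≡_ _≡_ τ →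
    (∀ {u} → Covered H u → τ u ≡ suc u) →
    ∀ e (missing : Missing (addVertex H) e) f → Missing H f → Match (λ x y → τ x ≡ y) f e →
    Contains (insertEdge (addVertex H) e missing p) G
  along τ τ-inj τ-old e missing f missing′ f↦e =
    transfer G R (λ { refl refl → refl }) (λ r s → τ-inj (trans r (sym s)))
      (insertEdge H f missing′ p) (insertEdge (addVertex H) e missing p)
      (insertAt-zip (Match R) (edges H) (edges (addVertex H)) p f↦e match)
      bound′ (Saturated.creates sat f missing′ p)
    where
    R : Fin n → Fin (suc n) → Set
    R x y = τ x ≡ y

    match : ∀ i → Match R (lookup (edges H) i) (lookup (edges (addVertex H)) i)
    match i rewrite lookup-map i sucEdge (edges H) =
      inj₁ (τ-old (i , inj₁ refl) , τ-old (i , inj₂ refl))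

  main : ∀ e (missing : Missing (addVertex H) e) →
         Contains (insertEdge (addVertex H) e missing p) G
  main e@(edge (suc a) (suc b) a<b) missing =
    along suc Fin.suc-injective (λ _ → refl) e missing (edge a b (ℕ.s<s⁻¹ a<b))
      (λ i eq → missing i (trans (lookup-map i sucEdge (edges H)) (cong sucEdge eq)))
      (inj₁ (refl , refl))
  -- The edge joins the new vertex to an old one. An uncovered `s` of `H` stands in for `zero`, and
  -- the missing edge between `s` and `b` stands in for `e`.
  main e@(edge zero (suc b) _) missing
    with s , s∉ ← fresh (b F.∷ endpoint H) 2k+1<n
    with f , f-ends ← pair s b (s∉ zero ∘ sym)
    = along τ τ-injective τ-covered e missing f missing′ (Sum.map τ-ends (swap ∘ τ-ends) f-ends)
    where
    -- Only `s` is redirected, so `suc s` is the uncovered vertex left out of the image.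
    τ : Fin n → Fin (suc n)
    τ x with x Fin.≟ s
    ... | yes _ = zero
    ... | no  _ = suc x

    τ-spare : τ s ≡ zero
    τ-spare with s Fin.≟ s
    ... | yes _ = refl
    ... | no ≢  = contradiction refl ≢

    τ-other : ∀ {x} → x ≢ s → τ x ≡ suc x
    τ-other {x} x≢s with x Fin.≟ s
    ... | yes x≡s = contradiction x≡s x≢s
    ... | no _    = refl

    τ-injective : Injective _≡_ _≡_ τ
    τ-injective {x} {y} eq with x Fin.≟ s | y Fin.≟ s
    ... | yes refl | yes refl = refl
    ... | no _     | no _     = Fin.suc-injective eq

    s-uncovered : ¬ Covered H s
    s-uncovered c = s∉ _ (proj₂ (covered⇒endpoint H c))

    τ-covered : ∀ {u} → Covered H u → τ u ≡ suc u
    τ-covered c = τ-other λ { refl → s-uncovered c }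

    τ-ends : ∀ {x y} → s ≡ x × b ≡ y → τ x ≡ zero × τ y ≡ suc b
    τ-ends (refl , refl) = τ-spare , τ-other (s∉ zero)

    missing′ : Missing H f
    missing′ i refl = s-uncovered (i , Sum.map proj₁ proj₁ f-ends)

addVertex-saturated : (G : EdgeOrderedGraph v m) (H : EdgeOrderedGraph n k) →
  k + k + (2 + v) ℕ.≤ n → Saturated G H → Saturated G (addVertex H)
addVertex-saturated {v = v} {k = k} G H bound sat = saturated
  (Saturated.free sat ∘ addVertex-free G H (ℕ.≤-trans (ℕ.+-monoʳ-≤ (k + k) (ℕ.m≤n+m v 2)) bound))
  (addVertex-creates G H sat bound)

-- The number of edges stays `k` while vertices are added, so the bound persists and the extension
-- can be repeated.
saturatedSize-+ : (G : EdgeOrderedGraph v m) → k + k + (2 + v) ℕ.≤ n →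
  SaturatedSize G n k → ∀ d → SaturatedSize G (d + n) k
saturatedSize-+ G bound s zero = s
saturatedSize-+ G bound s (suc d) with H , sat ← saturatedSize-+ G bound s d =
  addVertex H , addVertex-saturated G H (ℕ.≤-trans bound (ℕ.m≤n+m _ d)) sat

-- The role of a new edge between two isolated vertices.

lookup-insertAt-old : (es : Vec (Edge n) k) → ∀ p e {j} (p≢j : p ≢ j) →
                      lookup (insertAt es p e) j ≡ lookup es (punchOut p≢j)
lookup-insertAt-old es p e p≢j =
  trans (cong (lookup (insertAt es p e)) (sym (Fin.punchIn-punchOut p≢j)))
        (insertAt-punchIn es p e (punchOut p≢j))

-- If no edge received label `p`, punching `p` out would keep the labels increasing and give a copy
-- of `G` in `H` itself.
copy-uses-new : (G : EdgeOrderedGraph v m) (H : EdgeOrderedGraph n k) → ¬ Contains H G →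
  ∀ e (missing : Missing H e) p {φ ψ} → IsCopy G (insertEdge H e missing p) φ ψ →
  ∃[ i ] ψ i ≡ p
copy-uses-new G H free e missing p {φ} {ψ} (inj , mono , maps) =
  decidable-stable (Fin.any? λ i → ψ i Fin.≟ p) λ unused →
    let p≢ψ : ∀ i → p ≢ ψ i
        p≢ψ i p≡ψi = unused (i , sym p≡ψi)
    in free
      ( φ , (λ i → punchOut (p≢ψ i)) , inj
      , (λ i j i<j → Fin.≤∧≢⇒<
          (Fin.punchOut-mono-≤ (p≢ψ i) (p≢ψ j) (ℕ.<⇒≤ (mono i j i<j)))
          (Fin.<⇒≢ (mono i j i<j) ∘ Fin.punchOut-injective (p≢ψ i) (p≢ψ j)))
      , λ i → subst (MapsTo φ (lookup (edges G) i))
                (lookup-insertAt-old (edges H) p e (p≢ψ i)) (maps i) )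

copy-endpoint : (G : EdgeOrderedGraph v m) (H : EdgeOrderedGraph n k) → ∀ {φ ψ} →
  IsCopy G H φ ψ → ∀ i {u} → u ∈ₑ lookup (edges G) i → φ u ∈ₑ lookup (edges H) (ψ i)
copy-endpoint G H {φ} {ψ} (_ , _ , maps) i u∈
  with _ , refl , φu∈ ← match-image (λ x y → φ x ≡ y) (lookup (edges G) i)
                          (lookup (edges H) (ψ i)) (maps i) u∈
  = φu∈

-- A vertex shared by edges `i` and `j` of `G` would go to an endpoint of `e` that also lies on an
-- old edge of `H`.
new-edge-isolated : (G : EdgeOrderedGraph v m) (H : EdgeOrderedGraph n k) →
  ∀ e (missing : Missing H e) p {φ ψ} → IsCopy G (insertEdge H e missing p) φ ψ →
  (∀ {w} → w ∈ₑ e → ¬ Covered H w) → ∀ i → ψ i ≡ p → Isolated G i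
new-edge-isolated G H e missing p {φ} {ψ} copy@(_ , mono , _) uncovered i refl j j≢i u u∈i u∈j =
  uncovered
    (subst (φ u ∈ₑ_) (insertAt-lookup (edges H) p e) (copy-endpoint G H⁺ copy i u∈i))
    (_ , subst (φ u ∈ₑ_) (lookup-insertAt-old (edges H) p e ψi≢ψj)
           (copy-endpoint G H⁺ copy j u∈j))
  where
  H⁺ = insertEdge H e missing p

  ψi≢ψj : ψ i ≢ ψ j
  ψi≢ψj eq with Fin.<-cmp i j
  ... | tri< i<j _ _ = Fin.<⇒≢ (mono i j i<j) eq
  ... | tri≈ _ i≡j _ = j≢i (sym i≡j)
  ... | tri> _ _ j<i = Fin.<⇒≢ (mono j i j<i) (sym eq)

extremal-isolated : (G : EdgeOrderedGraph v m) (H : EdgeOrderedGraph n k) → Saturated G H →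
  k + k + 2 ℕ.≤ n → ∀ {e₀ eₘₐₓ} → Minimum _≤_ e₀ → Maximum _≤_ eₘₐₓ →
  Isolated G e₀ × Isolated G eₘₐₓ
extremal-isolated {m = m} {k = k} G H sat bound {e₀} {eₘₐₓ} min max
  with ι , ι-inj , uncovered ← uncovered-injection {r = 2} H bound
  with e , ends ← pair (ι zero) (ι (suc zero)) (λ eq → Fin.0≢1+n (ι-inj eq))
  -- After the insertion, `zero` and `fromℕ k` are the extreme labels; an increasing `ψ` can attain
  -- them only at `e₀` and `eₘₐₓ` respectively.
  = isolated zero e₀ (least-label _)
  , isolated (fromℕ k) eₘₐₓ (greatest-label _)
  where
  e-uncovered : ∀ {w} → w ∈ₑ e → ¬ Covered H w
  e-uncovered = go ends
    where
    go : ∀ {x y} → (ι zero ≡ x × ι (suc zero) ≡ y) ⊎ (ι zero ≡ y × ι (suc zero) ≡ x) →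
         ∀ {w} → w ≡ x ⊎ w ≡ y → ¬ Covered H w
    go (inj₁ (refl , refl)) (inj₁ refl) = uncovered zero
    go (inj₁ (refl , refl)) (inj₂ refl) = uncovered (suc zero)
    go (inj₂ (refl , refl)) (inj₁ refl) = uncovered (suc zero)
    go (inj₂ (refl , refl)) (inj₂ refl) = uncovered zero

  missing : Missing H e
  missing i refl = e-uncovered (inj₁ refl) (i , inj₁ refl)

  Increasing : (Fin m → Fin (suc k)) → Set
  Increasing ψ = ∀ i j → i < j → ψ i < ψ j

  isolated : ∀ p i → (∀ {ψ} → Increasing ψ → ∀ j → ψ j ≡ p → j ≡ i) → Isolated G i
  isolated p i unique
    with φ , ψ , copy@(_ , mono , _) ← Saturated.creates sat e missing p
    with j , ψj≡p ← copy-uses-new G H (Saturated.free sat) e missing p copy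
    with refl ← unique mono j ψj≡p
    = new-edge-isolated G H e missing p copy e-uncovered j ψj≡p

  least-label : ∀ ψ → Increasing ψ → ∀ i → ψ i ≡ zero → i ≡ e₀
  least-label ψ mono i eq with i Fin.≟ e₀
  ... | yes i≡e₀ = i≡e₀
  ... | no  i≢e₀ with mono e₀ i (Fin.≤∧≢⇒< (min i) (i≢e₀ ∘ sym))
  ...   | lt rewrite eq = contradiction lt ℕ.n≮0

  greatest-label : ∀ ψ → Increasing ψ → ∀ i → ψ i ≡ fromℕ k → i ≡ eₘₐₓ
  greatest-label ψ mono i eq with i Fin.≟ eₘₐₓ
  ... | yes i≡e = i≡e
  ... | no  i≢e with mono i eₘₐₓ (Fin.≤∧≢⇒< (max i) i≢e)
  ...   | lt rewrite eq = contradiction lt (ℕ.≤⇒≯ (Fin.≤fromℕ (ψ eₘₐₓ)))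

-- From edge counts to asymptotic bounds.

minimum-linear : ∀ {P : ℕ → ℕ → Set} {f} → (∀ n → IsMinimumOf (P n) (f n)) → ∀ r →
  (∀ n k → P n k → n ℕ.< k + k + r) → f ∈Ω (λ n → n)
minimum-linear {f = f} min r few =
  -- For `n` at least `r`, a value `k` of 0 would give `n < r`. For positive `k`, the summand `r` is
  -- at most `r * k`, whence the constant `2 + r`.
  2 + r , r , λ n r≤n → bound (f n) r≤n (few n (f n) (proj₁ (min n)))
  where
  bound : ∀ {n} k → r ℕ.≤ n → n ℕ.< k + k + r → n ℕ.≤ (2 + r) * k
  bound zero r≤n n<r = contradiction n<r (ℕ.≤⇒≯ r≤n)
  bound {n} k@(suc _) _ n<2k+r = begin
    n             ≤⟨ ℕ.<⇒≤ n<2k+r ⟩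
    k + k + r     ≡⟨ ℕ.+-assoc k k r ⟩
    k + (k + r)   ≤⟨ ℕ.+-monoʳ-≤ k (ℕ.+-monoʳ-≤ k (ℕ.m≤m*n r k)) ⟩
    (2 + r) * k   ∎
    where open ℕ.≤-Reasoning

minimum-bounded : ∀ {P : ℕ → ℕ → Set} {f} → (∀ n → IsMinimumOf (P n) (f n)) →
  ∀ {n k} → (∀ d → P (d + n) k) → f ∈O (λ _ → 1)
minimum-bounded {P} {f} min {n} {k} attained = k , n , λ n′ n≤n′ →
  subst (f n′ ℕ.≤_) (sym (ℕ.*-identityʳ k))
    (proj₂ (min n′) k (subst (λ l → P l k) (ℕ.m∸n+n≡m n≤n′) (attained (n′ ∸ n))))

bounded⊎linear : ExcludedMiddle 0ℓ → .{{_ : NonZero m}} (G : EdgeOrderedGraph v m) →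
  satₑ G ∈O (λ _ → 1) ⊎ satₑ G ∈Ω (λ n → n)
bounded⊎linear {v = v} em G = Sum.map
  (λ (_ , _ , s , bound) →
    minimum-bounded {P = SaturatedSize G} (satₑ-isMinimum G) (saturatedSize-+ G bound s))
  (λ none → minimum-linear {P = SaturatedSize G} (satₑ-isMinimum G) (2 + v) λ n k s →
    ℕ.≰⇒> λ bound → none (n , k , s , bound))
  -- Excluded middle settles an existential over all `n`, which exhaustive search at a single `n`
  -- does not cover.
  (toSum (em {∃[ n ] ∃[ k ] SaturatedSize G n k × k + k + (2 + v) ℕ.≤ n}))

theorem9 : ExcludedMiddle 0ℓ →
    ∀ {v m : ℕ} .{{_ : NonZero m}} (G : EdgeOrderedGraph v m)
    (e₀ eₘₐₓ : Fin m) → Minimum _≤_ e₀ → Maximum _≤_ eₘₐₓ →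
    (Isolated G e₀ × Isolated G eₘₐₓ →
    satₑ G ∈O (λ _ → 1) ⊎ satₑ G ∈Ω (λ n → n)) ×
    (¬ (Isolated G e₀ × Isolated G eₘₐₓ) →
    satₑ G ∈Ω (λ n → n))
theorem9 em G e₀ eₘₐₓ min max =
  (λ _ → bounded⊎linear em G) ,
  -- Here `r` is 2: two uncovered vertices already force both extremal edges to be isolated.
  λ ¬isolated → minimum-linear {P = SaturatedSize G} (satₑ-isMinimum G) 2 λ n k (H , sat) →
    ℕ.≰⇒> λ bound → ¬isolated (extremal-isolated G H sat bound min max)
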